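{- Let $r=[r_0,\ldots,r_m]$ and $c=[c_0,\ldots,c_n]$ be selections of rows and columns of the Pascal upper triangular matrix $T$, and let $\{\hat r,\hat c\}$ be an ordered sub-pair of $\{r,c\}$ of length $p+1\ge 1$, with $\hat r=[\hat r_0,\ldots,\hat r_p]$ and $\hat c=[\hat c_0,\ldots,\hat c_p]$. Then: (i) $T_{\hat r,\hat c}$ is a $(p+1)\times(p+1)$ invertible submatrix of $T_{r,c}$; (ii) $T_{\hat r,c}$ is a $(p+1)\times(n+1)$ matrix of full row rank $p+1$; (iii) $T_{r,\hat c}$ is an $(m+1)\times(p+1)$ matrix of full column rank $p+1$. If moreover $\{\hat r,\hat c\}$ is maximal, then: (iv) $\operatorname{rank}(T_{r,c})=p+1$; (v) the columns of $T_{r,\hat c}$ span the column space of $T_{r,c}$; (vi) the rows of $T_{\hat r,c}$ span the row space of $T_{r,c}$.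
   Context: The Pascal upper triangular matrix is the infinite matrix $T=(T_{i,j})_{i,j\ge 0}$ with $T_{i,j}=\binom{j}{i}$, where $\binom{j}{i}:=0$ if $i>j$ (rows and columns indexed from $0$). A selection of rows (resp. columns) is a strictly increasing finite sequence of nonnegative integers. For selections $r=[r_0,\ldots,r_m]$ and $c=[c_0,\ldots,c_n]$, $T_{r,c}$ denotes the $(m+1)\times(n+1)$ matrix whose $(i,j)$ entry is $\binom{c_j}{r_i}$. A pair $\{\hat r,\hat c\}$ is an ordered sub-pair of $\{r,c\}$ of length $p+1$ if $\hat r=[\hat r_0,\ldots,\hat r_p]$ is a subsequence of $r$, $\hat c=[\hat c_0,\ldots,\hat c_p]$ is a subsequence of $c$, and $\hat r_i\le \hat c_i$ for all $i=0,\ldots,p$ (the empty pair has length $0$). It is maximal if no ordered sub-pair of $\{r,c\}$ has length greater than $p+1$. -}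

module Defs where

open import Data.Bool.Base using (if_then_else_)
open import Data.Fin.Base as Fin using (Fin)
open import Data.Fin.Properties using (_≟_)
open import Data.Integer.Base using (+_)
open import Data.Nat.Base as ℕ using (ℕ)
open import Data.Nat.Combinatorics using (_C_)
open import Data.Product.Base using (∃; ∃-syntax; _×_)
open import Data.Rational.Base using (ℚ; 0ℚ; 1ℚ; _*_; _/_; +-0-rawMonoid)
open import Data.Vec.Functional using (Vector)
open import Function.Base using (flip)
open import Level using (0ℓ)
open import Relation.Binary.Definitions using (Monotonic₁)
open import Relation.Binary.PropositionalEquality using (_≡_; _≗_)
open import Relation.Nullary.Decidable using (does)
open import Relation.Unary using (Pred; _∈_)

open import Algebra.Definitions.RawMonoid +-0-rawMonoid using (sum)

-- There is no function extensionality, so vectors and matrices are always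
-- compared entrywise.

Matrix : ℕ → ℕ → Set
Matrix m n = Fin m → Fin n → ℚ

transpose : ∀ {m n} → Matrix m n → Matrix n m
transpose = flip

_·_ : ∀ {l m n} → Matrix l m → Matrix m n → Matrix l n
(A · B) i k = sum (λ j → A i j * B j k)

identity : ∀ {n} → Matrix n n
identity i j = if does (i ≟ j) then 1ℚ else 0ℚ

Invertible : ∀ {n} → Matrix n n → Set
Invertible {n} A = ∃[ B ]
  (∀ i j → (A · B) i j ≡ identity i j) × (∀ i j → (B · A) i j ≡ identity i j)

linearCombination : ∀ {d k} → Vector ℚ k → Vector (Vector ℚ d) k → Vector ℚ d
linearCombination a b i = sum (λ j → a j * b j i)

Span : ∀ {d k} → Vector (Vector ℚ d) k → Pred (Vector ℚ d) 0ℓ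
Span b v = ∃[ a ] v ≗ linearCombination a b

LinearlyIndependent : ∀ {d k} → Vector (Vector ℚ d) k → Set
LinearlyIndependent b =
  ∀ a → linearCombination a b ≗ (λ _ → 0ℚ) → a ≗ (λ _ → 0ℚ)

record IsBasis {d k} (W : Pred (Vector ℚ d) 0ℓ) (b : Vector (Vector ℚ d) k) : Set where
  field
    contained   : ∀ j → b j ∈ W
    independent : LinearlyIndependent b
    spanning    : ∀ v → v ∈ W → v ∈ Span b

HasDimension : ∀ {d} → Pred (Vector ℚ d) 0ℓ → ℕ → Set
HasDimension {d} W k = ∃ λ (b : Vector (Vector ℚ d) k) → IsBasis W b

RowSpace : ∀ {m n} → Matrix m n → Pred (Vector ℚ n) 0ℓ
RowSpace A = Span A

ColumnSpace : ∀ {m n} → Matrix m n → Pred (Vector ℚ m) 0ℓ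
ColumnSpace A = Span (transpose A)

HasRank : ∀ {m n} → Matrix m n → ℕ → Set
HasRank A k = HasDimension (ColumnSpace A) k

FullRowRank : ∀ {m n} → Matrix m n → Set
FullRowRank {m} {n} A = HasRank A m

FullColumnRank : ∀ {m n} → Matrix m n → Set
FullColumnRank {m} {n} A = HasRank A n

Selection : ∀ {k} → Vector ℕ k → Set
Selection s = Monotonic₁ Fin._<_ ℕ._<_ s

Subsequence : ∀ {k l} → Vector ℕ k → Vector ℕ l → Set
Subsequence {k} {l} t s = ∃ λ (f : Fin k → Fin l) →
  Monotonic₁ Fin._<_ Fin._<_ f × (∀ i → t i ≡ s (f i))

IsSubmatrix : ∀ {k l m n} → Matrix k l → Matrix m n → Set
IsSubmatrix {k} {l} {m} {n} B A =
  ∃ λ (f : Fin k → Fin m) → ∃ λ (g : Fin l → Fin n) →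
    Monotonic₁ Fin._<_ Fin._<_ f × Monotonic₁ Fin._<_ Fin._<_ g ×
    (∀ i j → B i j ≡ A (f i) (g j))

-- The library's j C i is 0 when i > j.

T : ℕ → ℕ → ℚ
T i j = + (j C i) / 1

T[_,_] : ∀ {m n} → Vector ℕ m → Vector ℕ n → Matrix m n
T[ r , c ] i j = T (r i) (c j)

record OrderedSubPair {m n k} (r : Vector ℕ m) (c : Vector ℕ n)
                      (r̂ ĉ : Vector ℕ k) : Set where
  field
    rows    : Subsequence r̂ r
    columns : Subsequence ĉ c
    ordered : ∀ i → r̂ i ℕ.≤ ĉ i

record MaximalOrderedSubPair {m n k} (r : Vector ℕ m) (c : Vector ℕ n)
                             (r̂ ĉ : Vector ℕ k) : Set where
  field
    orderedSubPair : OrderedSubPair r c r̂ ĉ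
    maximal        : ∀ {l} (r′ c′ : Vector ℕ l) → OrderedSubPair r c r′ c′ → l ℕ.≤ k

{-# OPTIONS --safe #-}
module Submission where

-- For Σ aᵢ C(t, rᵢ) with q + 1 nonzero coefficients, a discrete Descartes rule
-- (repeated differences and Rolle) bounds the number of alternating signs at
-- points t ≥ r₀ by q + 1. At t = r₀ the sum is a₀ ≢ 0, so it cannot also vanish
-- at c₀ < ⋯ < c_q when r₀ ≤ c₀: rows of an ordered pair are independent.
-- Trailing blocks of an ordered pair are ordered, so elimination without
-- pivoting inverts the matrix.
--
-- If {r̂, ĉ} is maximal, a further row x and column y cannot both be inserted.
-- Then some ρ with y < ρ ≤ x makes the bordered matrix block triangular, and the
-- combination of the rows r̂ agreeing with row x on ĉ involves only rows ≥ ρ,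
-- which all vanish in column y just as row x does.

open import Defs
open import Algebra.Bundles using (module CommutativeRing)
open import Data.Fin.Base as Fin using (Fin; zero; suc; punchIn; punchOut; toℕ; inject₁)
import Data.Fin.Properties as Fin
open import Data.Integer.Base as ℤ using (+_)
import Data.Integer.Properties as ℤ
open import Data.Nat.Base as ℕ using (ℕ; zero; suc; pred; _≤_; _<_; z≤n; s≤s; z<s)
open import Data.Nat.Combinatorics using (_C_; nCn≡1; nCk≡nC[n∸k]; k>n⇒nCk≡0; nCk+nC[k+1]≡[n+1]C[k+1])
import Data.Nat.Properties as ℕ
open import Data.Product.Base using (∃-syntax; _×_; _,_; proj₁; proj₂)
open import Data.Rational.Base as ℚ using (ℚ; 0ℚ; 1ℚ; _+_; _*_; _/_; -_; 1/_; fromℚᵘ; toℚᵘ)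
import Data.Rational.Properties as ℚ
open import Data.Rational.Solver using (module +-*-Solver)
import Data.Rational.Unnormalised.Base as ℚᵘ
import Data.Rational.Unnormalised.Properties as ℚᵘ
open import Data.Sign.Base as Sign using (Sign; opposite)
open import Data.Sign.Properties using (opposite-involutive)
open import Data.Sum.Base using (_⊎_; inj₁; inj₂)
open import Data.Unit.Base using (⊤; tt)
open import Data.Vec.Functional using (Vector; head; tail; removeAt; _∷_)
open import Function.Base using (_∘_; case_of_)
open import Relation.Binary.Definitions using (Monotonic₁)
open import Relation.Binary.PropositionalEquality
open import Relation.Nullary.Decidable using (Dec; yes; no)
open import Relation.Nullary.Negation using (¬_; contradiction)
open import Relation.Unary using (_≐_; _∈_; _⊆_)

open import Algebra.Properties.Semiring.Sum (CommutativeRing.semiring ℚ.+-*-commutativeRing)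

open ≡-Reasoning

-- Order of selections and entries of the Pascal matrix.

Selection-head-≤ : ∀ {k} {r : Vector ℕ (suc k)} → Selection r → ∀ i → r zero ≤ r i
Selection-head-≤ r↑ zero    = ℕ.≤-refl
Selection-head-≤ r↑ (suc i) = ℕ.<⇒≤ (r↑ z<s)

punchIn-mono-< : ∀ {k} (i : Fin (suc k)) → Monotonic₁ Fin._<_ Fin._<_ (punchIn i)
punchIn-mono-< i {j} {l} j<l = ℕ.≤∧≢⇒<
  (Fin.punchIn-mono-≤ i j l (ℕ.<⇒≤ j<l))
  (λ eq → Fin.<⇒≢ j<l (Fin.punchIn-injective i j l (Fin.toℕ-injective eq)))

-- `_/_` normalises fractions, so the two sides are compared as unnormalised rationals, where this
-- is an identity of integers.
/1-homo-+ : ∀ a b → + (a ℕ.+ b) / 1 ≡ + a / 1 + + b / 1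
/1-homo-+ a b = ℚ.toℚᵘ-injective (begin-≃
  toℚᵘ (fromℚᵘ (a+b))                ≈⟨ ℚ.toℚᵘ-fromℚᵘ a+b ⟩
  a+b                                ≈⟨ ℚᵘ.*≡* (cong (ℤ._* ℤ.1ℤ) (cong₂ ℤ._+_ (sym (ℤ.*-identityʳ (+ a))) (sym (ℤ.*-identityʳ (+ b))))) ⟩
  ⟦ a ⟧ ℚᵘ.+ ⟦ b ⟧                   ≈⟨ ℚᵘ.+-cong (ℚ.toℚᵘ-fromℚᵘ ⟦ a ⟧) (ℚ.toℚᵘ-fromℚᵘ ⟦ b ⟧) ⟨
  toℚᵘ (fromℚᵘ ⟦ a ⟧) ℚᵘ.+ toℚᵘ (fromℚᵘ ⟦ b ⟧)    ≈⟨ ℚ.toℚᵘ-homo-+ (+ a / 1) (+ b / 1) ⟨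
  toℚᵘ (+ a / 1 + + b / 1)           ∎≃)
  where
  open import Relation.Binary.Reasoning.Setoid ℚᵘ.≃-setoid
    using (step-≈-⟩; step-≈-⟨) renaming (begin_ to begin-≃_; _∎ to _∎≃)
  ⟦_⟧ : ℕ → ℚᵘ.ℚᵘ
  ⟦ n ⟧ = ℚᵘ.mkℚᵘ (+ n) 0
  a+b = ⟦ a ℕ.+ b ⟧

T-zero : ∀ t → T 0 t ≡ 1ℚ
T-zero t = cong (λ n → + n / 1) (trans (nCk≡nC[n∸k] {0} {t} z≤n) (nCn≡1 t))

T-diagonal : ∀ i → T i i ≡ 1ℚ
T-diagonal i = cong (λ n → + n / 1) (nCn≡1 i)

T-below : ∀ {i t} → t < i → T i t ≡ 0ℚ
T-below t<i = cong (λ n → + n / 1) (k>n⇒nCk≡0 t<i)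

T-pascal : ∀ i t → T (suc i) (suc t) ≡ T (suc i) t + T i t
T-pascal i t = begin
  + (suc t C suc i) / 1             ≡⟨ cong (λ n → + n / 1) (sym (nCk+nC[k+1]≡[n+1]C[k+1] t i)) ⟩
  + (t C i ℕ.+ t C suc i) / 1       ≡⟨ /1-homo-+ (t C i) (t C suc i) ⟩
  T i t + T (suc i) t               ≡⟨ ℚ.+-comm (T i t) (T (suc i) t) ⟩
  T (suc i) t + T i t               ∎

-- Newton sums and their forward differences.

sum-zero : ∀ {k} (f : Vector ℚ k) → (∀ i → f i ≡ 0ℚ) → sum f ≡ 0ℚ
sum-zero {k} f f≡0 = trans (sum-cong-≗ f≡0) (sum-replicate-zero k)

-- A polynomial in the Newton basis. Entry `j` of `linearCombination a T[ r , c ]` is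
-- `newton a r (c j)`, so relations between rows become statements about zeros.
newton : ∀ {k} → Vector ℚ k → Vector ℕ k → ℕ → ℚ
newton a r t = sum (λ i → a i * T (r i) t)

newton-below : ∀ {k} (a : Vector ℚ k) r {t} → (∀ i → t < r i) → newton a r t ≡ 0ℚ
newton-below a r t<r = sum-zero _ λ i →
  trans (cong (a i *_) (T-below (t<r i))) (ℚ.*-zeroʳ (a i))

-- Pascal's rule in each term. Positivity matters: `T 0` is constant with difference 0, but `pred 0`
-- is 0.
newton-step : ∀ {k} (a : Vector ℚ k) r → (∀ i → 0 < r i) →
  ∀ t → newton a r (suc t) ≡ newton a r t + newton a (pred ∘ r) t
newton-step a r 0<r t = trans
  (sum-cong-≗ λ i → trans (cong (a i *_) (step (r i) (0<r i))) (ℚ.*-distribˡ-+ (a i) _ _))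
  (∑-distrib-+ (λ i → a i * T (r i) t) (λ i → a i * T (pred (r i)) t))
  where
  step : ∀ n → 0 < n → T n (suc t) ≡ T n t + T (pred n) t
  step (suc n) _ = T-pascal n t

newton-head : ∀ {k} (a : Vector ℚ (suc k)) r → r zero ≡ 0 →
  ∀ t → newton a r t ≡ a zero + newton (tail a) (tail r) t
newton-head a r r₀≡0 t = cong (_+ newton (tail a) (tail r) t) (begin
  a zero * T (r zero) t ≡⟨ cong (λ n → a zero * T n t) r₀≡0 ⟩
  a zero * T 0 t        ≡⟨ cong (a zero *_) (T-zero t) ⟩
  a zero * 1ℚ           ≡⟨ ℚ.*-identityʳ (a zero) ⟩
  a zero                ∎)

-- The constant term has difference 0, so this difference has one term fewer.
newton-tail-step : ∀ {k} (a : Vector ℚ (suc k)) r → r zero ≡ 0 → (∀ i → 0 < tail r i) →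
  ∀ t → newton a r (suc t) ≡ newton a r t + newton (tail a) (pred ∘ tail r) t
newton-tail-step a r r₀≡0 0<r t = begin
  newton a r (suc t)                                    ≡⟨ newton-head a r r₀≡0 (suc t) ⟩
  a zero + newton (tail a) (tail r) (suc t)             ≡⟨ cong (λ x → a zero + x) (newton-step (tail a) (tail r) 0<r t) ⟩
  a zero + (newton (tail a) (tail r) t + Δ)             ≡⟨ ℚ.+-assoc (a zero) _ Δ ⟨
  a zero + newton (tail a) (tail r) t + Δ               ≡⟨ cong (_+ Δ) (newton-head a r r₀≡0 t) ⟨
  newton a r t + Δ                                      ∎
  where Δ = newton (tail a) (pred ∘ tail r) t

newton-constant : ∀ {k} (a : Vector ℚ (suc k)) r → r zero ≡ 0 →
  ∀ {t} → (∀ i → t < tail r i) → newton a r t ≡ a zero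
newton-constant a r r₀≡0 {t} t<r = begin
  newton a r t                         ≡⟨ newton-head a r r₀≡0 t ⟩
  a zero + newton (tail a) (tail r) t  ≡⟨ cong (λ x → a zero + x) (newton-below (tail a) (tail r) t<r) ⟩
  a zero + 0ℚ                          ≡⟨ ℚ.+-identityʳ (a zero) ⟩
  a zero                               ∎

-- Triangularity: in column `r zero` the first row has entry 1 and all later rows vanish.
newton-at-head : ∀ {k} (a : Vector ℚ (suc k)) r → Selection r → newton a r (r zero) ≡ a zero
newton-at-head a r r↑ = begin
  a zero * T (r zero) (r zero) + newton (tail a) (tail r) (r zero)
    ≡⟨ cong₂ (λ x y → a zero * x + y) (T-diagonal (r zero)) (newton-below (tail a) (tail r) (λ i → r↑ z<s)) ⟩
  a zero * 1ℚ + 0ℚ  ≡⟨ ℚ.+-identityʳ _ ⟩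
  a zero * 1ℚ       ≡⟨ ℚ.*-identityʳ (a zero) ⟩
  a zero            ∎

newton-removeAt : ∀ {k} (a : Vector ℚ (suc k)) r i → a i ≡ 0ℚ →
  ∀ t → newton a r t ≡ newton (removeAt a i) (removeAt r i) t
newton-removeAt a r i aᵢ≡0 t = begin
  newton a r t                  ≡⟨ sum-remove {i = i} (λ j → a j * T (r j) t) ⟩
  a i * T (r i) t + rest        ≡⟨ cong (λ x → x * T (r i) t + rest) aᵢ≡0 ⟩
  0ℚ * T (r i) t + rest         ≡⟨ cong (_+ rest) (ℚ.*-zeroˡ (T (r i) t)) ⟩
  0ℚ + rest                     ≡⟨ ℚ.+-identityˡ rest ⟩
  rest                          ∎
  where rest = newton (removeAt a i) (removeAt r i) t

-- Sign alternations and the discrete Descartes rule.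

HasSign : Sign → ℚ → Set
HasSign Sign.+ x = 0ℚ ℚ.≤ x
HasSign Sign.- x = x ℚ.≤ 0ℚ

hasSign? : ∀ σ x → Dec (HasSign σ x)
hasSign? Sign.+ x = 0ℚ ℚ.≤? x
hasSign? Sign.- x = x ℚ.≤? 0ℚ

hasSign-0 : ∀ σ → HasSign σ 0ℚ
hasSign-0 Sign.+ = ℚ.≤-refl
hasSign-0 Sign.- = ℚ.≤-refl

hasSign-some : ∀ x → ∃[ σ ] HasSign σ x
hasSign-some x with ℚ.≤-total 0ℚ x
... | inj₁ 0≤x = Sign.+ , 0≤x
... | inj₂ x≤0 = Sign.- , x≤0

hasSign-both : ∀ σ {x} → HasSign σ x → HasSign (opposite σ) x → x ≡ 0ℚ
hasSign-both Sign.+ 0≤x x≤0 = ℚ.≤-antisym x≤0 0≤x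
hasSign-both Sign.- x≤0 0≤x = ℚ.≤-antisym x≤0 0≤x

¬hasSign-opposite : ∀ σ {x} → ¬ HasSign (opposite σ) x → HasSign σ x
¬hasSign-opposite Sign.+ x≰0 = ℚ.<⇒≤ (ℚ.≰⇒> x≰0)
¬hasSign-opposite Sign.- 0≰x = ℚ.<⇒≤ (ℚ.≰⇒> 0≰x)

hasSign-+ : ∀ σ {x y} → HasSign σ x → HasSign σ y → HasSign σ (x + y)
hasSign-+ Sign.+ = ℚ.+-mono-≤
hasSign-+ Sign.- = ℚ.+-mono-≤

-- `¬ HasSign (opposite σ)` is the strict form of the sign `σ`, and weak plus strict is strict.
¬hasSign-opposite-+ : ∀ σ {x y} → HasSign σ x → ¬ HasSign (opposite σ) y → ¬ HasSign (opposite σ) (x + y)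
¬hasSign-opposite-+ Sign.+ 0≤x y≰0 x+y≤0 =
  ℚ.<-irrefl refl (ℚ.<-≤-trans (ℚ.+-mono-≤-< 0≤x (ℚ.≰⇒> y≰0)) x+y≤0)
¬hasSign-opposite-+ Sign.- x≤0 0≰y 0≤x+y =
  ℚ.<-irrefl refl (ℚ.≤-<-trans 0≤x+y (ℚ.+-mono-≤-< x≤0 (ℚ.≰⇒> 0≰y)))

-- n points s ≤ t₀ < t₁ < ⋯ at which F has the signs σ, −σ, σ, …; the value 0
-- counts for both signs.
Alternating : Sign → (ℕ → ℚ) → ℕ → ℕ → Set
Alternating σ F zero    s = ⊤
Alternating σ F (suc n) s =
  ∃[ t ] s ≤ t × HasSign σ (F t) × Alternating (opposite σ) F n (suc t)

alternating-weaken : ∀ σ {F} n {s s′} → s′ ≤ s → Alternating σ F n s → Alternating σ F n s′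
alternating-weaken σ zero    s′≤s _                      = tt
alternating-weaken σ (suc n) s′≤s (t , s≤t , w , rest) = t , ℕ.≤-trans s′≤s s≤t , w , rest

-- Discrete Rolle. As long as `G` lacks the opposite sign it is strictly of sign `σ`, and `F` keeps
-- the sign `σ`; lasting to the final step, this would make the last value strictly of sign `σ`.
difference-sign : ∀ σ {F G : ℕ → ℚ} → (∀ t → F (suc t) ≡ F t + G t) →
  ∀ d t → HasSign σ (F t) → HasSign (opposite σ) (F (suc (t ℕ.+ d))) →
  ∃[ s ] t ≤ s × s ≤ t ℕ.+ d × HasSign (opposite σ) (G s)
difference-sign σ {F} {G} ΔF d t w w′ with hasSign? (opposite σ) (G t)
... | yes v = t , ℕ.≤-refl , ℕ.m≤m+n t d , v
difference-sign σ {F} {G} ΔF zero t w w′ | no ¬v = contradiction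
  (subst (HasSign (opposite σ)) (trans (cong (F ∘ suc) (ℕ.+-identityʳ t)) (ΔF t)) w′)
  (¬hasSign-opposite-+ σ w ¬v)
difference-sign σ {F} {G} ΔF (suc d) t w w′ | no ¬v
  with s , t<s , s≤ , v ← difference-sign σ {F} ΔF d (suc t)
         (subst (HasSign σ) (sym (ΔF t)) (hasSign-+ σ w (¬hasSign-opposite σ ¬v)))
         (subst (λ n → HasSign (opposite σ) (F (suc n))) (ℕ.+-suc t d) w′)
  = s , ℕ.<⇒≤ t<s , subst (s ≤_) (sym (ℕ.+-suc t d)) s≤ , v

alternating-difference : ∀ σ {F G : ℕ → ℚ} → (∀ t → F (suc t) ≡ F t + G t) →
  ∀ n {s} → Alternating σ F (suc n) s → Alternating (opposite σ) G n s
alternating-difference σ ΔF zero _ = tt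
alternating-difference σ {F} ΔF (suc n) (t , s≤t , w , t′ , t<t′ , w′ , rest)
  with ℕ.m≤n⇒∃[o]m+o≡n t<t′
... | d , refl with difference-sign σ {F} ΔF d t w w′
... | u , t≤u , u≤ , v = u , ℕ.≤-trans s≤t t≤u , v ,
  -- The point `u` lies before the second point of its pair, where the search for the next one
  -- starts, so the points found increase strictly.
  alternating-weaken _ n (s≤s u≤) (alternating-difference (opposite σ) ΔF n (_ , ℕ.≤-refl , w′ , rest))

-- A nonzero constant shows only one sign, so at most the first point lies before `d`, and it can be
-- moved to `d` without changing the value of `F`.
alternating-after-constant : ∀ σ {F x} n {s} d → x ≢ 0ℚ → (∀ t → t ≤ d → F t ≡ x) →
  Alternating σ F (2 ℕ.+ n) s → Alternating σ F (2 ℕ.+ n) d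
alternating-after-constant σ n d x≢0 F≡x (t , _ , w , t′ , t<t′ , w′ , rest)
  with d ℕ.≤? t | t′ ℕ.≤? d
... | yes d≤t | _        = t , d≤t , w , t′ , t<t′ , w′ , rest
... | no d≰t  | no t′≰d  = d , ℕ.≤-refl ,
  subst (HasSign σ) (trans (F≡x t (ℕ.≰⇒≥ d≰t)) (sym (F≡x d ℕ.≤-refl))) w ,
  t′ , ℕ.≰⇒> t′≰d , w′ , rest
... | no d≰t  | yes t′≤d = contradiction
  (hasSign-both σ (subst (HasSign σ) (F≡x t (ℕ.≰⇒≥ d≰t)) w)
                  (subst (HasSign (opposite σ)) (F≡x t′ t′≤d) w′))
  x≢0

-- A discrete Descartes rule: taking differences lowers every r i by one and
-- kills a constant term, and by Rolle it costs at most one alternation, none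
-- when F vanishes just before its first nonzero value.
newton-alternations : ∀ q k (a : Vector ℚ (suc q)) (r : Vector ℕ (suc q)) → r zero ≡ k →
  Selection r → (∀ i → a i ≢ 0ℚ) → ∀ σ → ¬ Alternating σ (newton a r) (2 ℕ.+ q) k
newton-alternations zero zero a r r₀≡0 r↑ a≢0 σ (t , _ , w , t′ , _ , w′ , _) =
  a≢0 zero (hasSign-both σ (subst (HasSign σ) (constant t) w) (subst (HasSign (opposite σ)) (constant t′) w′))
  where
  constant : ∀ t → newton a r t ≡ a zero
  constant t = newton-constant a r r₀≡0 {t} λ ()
newton-alternations (suc q) zero a r r₀≡0 r↑ a≢0 σ alt =
  newton-alternations q d (tail a) (pred ∘ tail r) refl
    (λ i<j → ℕ.pred-mono-< {{ℕ.>-nonZero (0<r _)}} (r↑ (s≤s i<j))) (a≢0 ∘ suc) (opposite σ)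
    (alternating-difference σ (newton-tail-step a r r₀≡0 0<r) (2 ℕ.+ q)
      (alternating-after-constant σ (1 ℕ.+ q) d (a≢0 zero) (λ _ → constant) alt))
  where
  0<r : ∀ i → 0 < tail r i
  0<r i = subst (_< tail r i) r₀≡0 (r↑ z<s)

  -- The first index of the difference, from which the recursive call counts. The sum is constant up
  -- to `d` because the second index is `d + 1`.
  d = pred (r (suc zero))

  constant : ∀ {t} → t ≤ d → newton a r t ≡ a zero
  constant {t} t≤d = newton-constant a r r₀≡0 λ i → ℕ.<-≤-trans
    (subst (t <_) (ℕ.suc-pred _ {{ℕ.>-nonZero (0<r zero)}}) (s≤s t≤d))
    (Selection-head-≤ {r = tail r} (r↑ ∘ s≤s) i)
newton-alternations q (suc k) a r r₀≡1+k r↑ a≢0 σ alt =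
  newton-alternations q k a (pred ∘ r) (cong pred r₀≡1+k)
    (λ i<j → ℕ.pred-mono-< {{ℕ.>-nonZero (0<r _)}} (r↑ i<j)) a≢0 (opposite (opposite σ))
    (alternating-difference (opposite σ) (newton-step a r 0<r) (2 ℕ.+ q)
      -- The zero at `k` counts with either sign and is put in front as an extra point, which makes
      -- up for the one lost by differencing.
      (k , ℕ.≤-refl , subst (HasSign (opposite σ)) (sym Fk≡0) (hasSign-0 (opposite σ)) ,
       subst (λ σ → Alternating σ (newton a r) (2 ℕ.+ q) (suc k)) (sym (opposite-involutive σ)) alt))
  where
  k<r : ∀ i → k < r i
  k<r i = subst (_≤ r i) r₀≡1+k (Selection-head-≤ {r = r} r↑ i)

  0<r : ∀ i → 0 < r i
  0<r i = ℕ.≤-<-trans z≤n (k<r i)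

  Fk≡0 : newton a r k ≡ 0ℚ
  Fk≡0 = newton-below a r k<r

alternating-zeros : ∀ σ {F : ℕ → ℚ} {k s} {c : Vector ℕ k} → Selection c → (∀ i → s ≤ c i) →
  (∀ i → F (c i) ≡ 0ℚ) → Alternating σ F k s
alternating-zeros σ {k = zero}  c↑ s≤c F≡0 = tt
alternating-zeros σ {F} {k = suc k} {c = c} c↑ s≤c F≡0 =
  c zero , s≤c zero , subst (HasSign σ) (sym (F≡0 zero)) (hasSign-0 σ) ,
  alternating-zeros (opposite σ) {c = tail c} (c↑ ∘ s≤s) (λ i → c↑ z<s) (F≡0 ∘ suc)

-- The `q + 1` zeros take whatever signs are wanted, so `r zero` followed by them gives `2 + q`
-- alternating points, one more than the Descartes rule allows.
newton-zeros : ∀ {q} (a : Vector ℚ (suc q)) (r c : Vector ℕ (suc q)) → Selection r → Selection c →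
  r zero ≤ c zero → (∀ i → newton a r (c i) ≡ 0ℚ) → ¬ (∀ i → a i ≢ 0ℚ)
newton-zeros {q} a r c r↑ c↑ r₀≤c₀ F≡0 a≢0 = newton-alternations q (r zero) a r refl r↑ a≢0 σ
  (r zero , ℕ.≤-refl , proj₂ sign ,
   alternating-zeros (opposite σ) {c = c} c↑ (λ i → ℕ.<-≤-trans r₀<c₀ (Selection-head-≤ {r = c} c↑ i)) F≡0)
  where
  sign = hasSign-some (newton a r (r zero))
  σ = proj₁ sign

  r₀<c₀ : r zero < c zero
  r₀<c₀ = ℕ.≤∧≢⇒< r₀≤c₀ λ r₀≡c₀ → a≢0 zero (begin
    a zero                 ≡⟨ newton-at-head a r r↑ ⟨
    newton a r (r zero)    ≡⟨ cong (newton a r) r₀≡c₀ ⟩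
    newton a r (c zero)    ≡⟨ F≡0 zero ⟩
    0ℚ                     ∎)

-- Vanishing is only required at the c j with a j ≢ 0, which lets the lemma be
-- applied to a vector supported on an initial part of r.
newton-injective : ∀ {k} (a : Vector ℚ k) (r c : Vector ℕ k) → Selection r → Selection c →
  (∀ i → r i ≤ c i) → (∀ j → a j ≢ 0ℚ → newton a r (c j) ≡ 0ℚ) → ∀ i → a i ≡ 0ℚ
newton-injective {zero}  a r c r↑ c↑ r≤c F≡0 ()
newton-injective {suc k} a r c r↑ c↑ r≤c F≡0 j = case Fin.any? (λ i → a i ℚ.≟ 0ℚ) of λ where
  (no ∄0) → contradiction (λ i aᵢ≡0 → ∄0 (i , aᵢ≡0))
    (newton-zeros a r c r↑ c↑ (r≤c zero) λ i → F≡0 i λ aᵢ≡0 → ∄0 (i , aᵢ≡0))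
  (yes (i , aᵢ≡0)) → case i Fin.≟ j of λ where
    (yes i≡j) → subst (λ l → a l ≡ 0ℚ) i≡j aᵢ≡0
    (no  i≢j) → subst (λ l → a l ≡ 0ℚ) (Fin.punchIn-punchOut i≢j)
      -- Dropping row and column of the same index keeps the pair ordered, and since the coefficient
      -- is 0 the sum keeps its values.
      (newton-injective (removeAt a i) (removeAt r i) (removeAt c i)
        (r↑ ∘ punchIn-mono-< i) (c↑ ∘ punchIn-mono-< i) (r≤c ∘ punchIn i)
        (λ l aₗ≢0 → trans (sym (newton-removeAt a r i aᵢ≡0 _)) (F≡0 (punchIn i l) aₗ≢0))
        (punchOut i≢j))

-- Linear combinations and spans.

linearCombination-congʳ : ∀ {d k} (a : Vector ℚ k) (b b′ : Vector (Vector ℚ d) k) →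
  ∀ i → (∀ j → b j i ≡ b′ j i) → linearCombination a b i ≡ linearCombination a b′ i
linearCombination-congʳ a b b′ i b≗b′ = sum-cong-≗ λ j → cong (a j *_) (b≗b′ j)

linearCombination-zeroˡ : ∀ {d k} {a : Vector ℚ k} (b : Vector (Vector ℚ d) k) →
  a ≗ (λ _ → 0ℚ) → linearCombination a b ≗ (λ _ → 0ℚ)
linearCombination-zeroˡ b a≗0 i = sum-zero _ λ j →
  trans (cong (_* b j i) (a≗0 j)) (ℚ.*-zeroˡ (b j i))

-- The form `a + x a′` serves both subtraction, with `x` equal to `- 1ℚ`, and row elimination.
linearCombination-+-* : ∀ {d k} (a a′ : Vector ℚ k) x (b : Vector (Vector ℚ d) k) →
  ∀ i → linearCombination (λ j → a j + x * a′ j) b i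
      ≡ linearCombination a b i + x * linearCombination a′ b i
linearCombination-+-* a a′ x b i = begin
  sum (λ j → (a j + x * a′ j) * b j i)
    ≡⟨ sum-cong-≗ (λ j → trans (ℚ.*-distribʳ-+ (b j i) (a j) (x * a′ j))
                              (cong (λ y → a j * b j i + y) (ℚ.*-assoc x (a′ j) (b j i)))) ⟩
  sum (λ j → a j * b j i + x * (a′ j * b j i))
    ≡⟨ ∑-distrib-+ (λ j → a j * b j i) (λ j → x * (a′ j * b j i)) ⟩
  linearCombination a b i + sum (λ j → x * (a′ j * b j i))
    ≡⟨ cong (λ y → linearCombination a b i + y) (sym (*-distribˡ-sum x (λ j → a′ j * b j i))) ⟩
  linearCombination a b i + x * linearCombination a′ b i ∎

-- Both sides are the bilinear form of `M` at `a` and `x`, summed in the two orders.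
linearCombination-swap : ∀ {k l} (a : Vector ℚ k) (x : Vector ℚ l) (M : Matrix k l) →
  sum (λ j → a j * linearCombination x (transpose M) j) ≡ sum (λ i → x i * linearCombination a M i)
linearCombination-swap a x M = begin
  sum (λ j → a j * sum (λ i → x i * M j i))
    ≡⟨ sum-cong-≗ (λ j → *-distribˡ-sum (a j) (λ i → x i * M j i)) ⟩
  sum (λ j → sum (λ i → a j * (x i * M j i)))
    ≡⟨ ∑-comm (λ j i → a j * (x i * M j i)) ⟩
  sum (λ i → sum (λ j → a j * (x i * M j i)))
    ≡⟨ sum-cong-≗ (λ i → sum-cong-≗ λ j → exchange (a j) (x i) (M j i)) ⟩
  sum (λ i → sum (λ j → x i * (a j * M j i)))
    ≡⟨ sum-cong-≗ (λ i → sym (*-distribˡ-sum (x i) (λ j → a j * M j i))) ⟩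
  sum (λ i → x i * sum (λ j → a j * M j i)) ∎
  where
  exchange : ∀ p q s → p * (q * s) ≡ q * (p * s)
  exchange = solve 3 (λ p q s → p :* (q :* s) := q :* (p :* s)) refl
    where open +-*-Solver

-- With the vectors of `b` as rows, `linearCombination a b` is the product of a row vector and a
-- matrix, and this is associativity.
linearCombination-assoc : ∀ {d k l} (a : Vector ℚ k) (A : Matrix k l) (b : Vector (Vector ℚ d) l) →
  linearCombination (linearCombination a A) b ≗ linearCombination a (A · b)
linearCombination-assoc a A b i = begin
  sum (λ j → linearCombination a A j * b j i)
    ≡⟨ sum-cong-≗ (λ j → ℚ.*-comm (linearCombination a A j) (b j i)) ⟩
  sum (λ j → b j i * linearCombination a A j)
    ≡⟨ linearCombination-swap a (λ j → b j i) A ⟨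
  sum (λ j → a j * sum (λ l → b l i * A j l))
    ≡⟨ sum-cong-≗ (λ j → cong (a j *_) (sum-cong-≗ λ l → ℚ.*-comm (b l i) (A j l))) ⟩
  sum (λ j → a j * sum (λ l → A j l * b l i)) ∎

identity-sym : ∀ {n} (i j : Fin n) → identity i j ≡ identity j i
identity-sym zero    zero    = refl
identity-sym zero    (suc j) = refl
identity-sym (suc i) zero    = refl
identity-sym (suc i) (suc j) = identity-sym i j

linearCombination-identityˡ : ∀ {d k} l (b : Vector (Vector ℚ d) k) → linearCombination (identity l) b ≗ b l
linearCombination-identityˡ {k = suc k} zero b i = begin
  1ℚ * b zero i + sum {k} (λ j → 0ℚ * b (suc j) i)  ≡⟨ cong₂ _+_ (ℚ.*-identityˡ (b zero i)) (linearCombination-zeroˡ (tail b) (λ _ → refl) i) ⟩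
  b zero i + 0ℚ                                     ≡⟨ ℚ.+-identityʳ (b zero i) ⟩
  b zero i                                          ∎
linearCombination-identityˡ {k = suc k} (suc l) b i = begin
  0ℚ * b zero i + linearCombination (identity l) (tail b) i  ≡⟨ cong₂ _+_ (ℚ.*-zeroˡ (b zero i)) (linearCombination-identityˡ l (tail b) i) ⟩
  0ℚ + b (suc l) i                                           ≡⟨ ℚ.+-identityˡ (b (suc l) i) ⟩
  b (suc l) i                                                ∎

linearCombination-identityʳ : ∀ {k} (a : Vector ℚ k) → linearCombination a identity ≗ a
linearCombination-identityʳ a i = begin
  sum (λ j → a j * identity j i)  ≡⟨ sum-cong-≗ (λ j → trans (ℚ.*-comm (a j) (identity j i)) (cong (_* a j) (identity-sym j i))) ⟩
  -- The scalars `a j` are read as vectors of dimension one.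
  sum (λ j → identity i j * a j)  ≡⟨ linearCombination-identityˡ i (λ j (_ : Fin 1) → a j) zero ⟩
  a i                             ∎

Span-generator : ∀ {d k} (b : Vector (Vector ℚ d) k) j → b j ∈ Span b
Span-generator b j = identity j , λ i → sym (linearCombination-identityˡ j b i)

Span-resp-≗ : ∀ {d k} (b : Vector (Vector ℚ d) k) {v w} → v ≗ w → w ∈ Span b → v ∈ Span b
Span-resp-≗ b v≗w (a , w≗) = a , λ i → trans (v≗w i) (w≗ i)

Span-least : ∀ {d k l} (b : Vector (Vector ℚ d) k) (b′ : Vector (Vector ℚ d) l) →
  (∀ j → b j ∈ Span b′) → Span b ⊆ Span b′
Span-least b b′ b∈ {v} (a , v≗) = linearCombination a A , λ i → begin
  v i                                         ≡⟨ v≗ i ⟩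
  linearCombination a b i                     ≡⟨ linearCombination-congʳ a b (A · b′) i (λ j → proj₂ (b∈ j) i) ⟩
  linearCombination a (A · b′) i              ≡⟨ linearCombination-assoc a A b′ i ⟨
  linearCombination (linearCombination a A) b′ i ∎
  where A = λ j → proj₁ (b∈ j)

independent-injective : ∀ {d k} {b : Vector (Vector ℚ d) k} → LinearlyIndependent b →
  ∀ a a′ → linearCombination a b ≗ linearCombination a′ b → a ≗ a′
independent-injective {b = b} ind a a′ eq j = begin
  a j                             ≡⟨ rearrange (a j) (a′ j) ⟩
  (a j + - 1ℚ * a′ j) + a′ j      ≡⟨ cong (_+ a′ j) (ind (λ j → a j + - 1ℚ * a′ j) vanishes j) ⟩
  0ℚ + a′ j                       ≡⟨ ℚ.+-identityˡ (a′ j) ⟩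
  a′ j                            ∎
  where
  open +-*-Solver
  rearrange : ∀ p q → p ≡ (p + - 1ℚ * q) + q
  rearrange = solve 2 (λ p q → p := (p :+ :- con 1ℚ :* q) :+ q) refl

  cancel : ∀ p → p + - 1ℚ * p ≡ 0ℚ
  cancel = solve 1 (λ p → p :+ :- con 1ℚ :* p := con 0ℚ) refl

  vanishes : linearCombination (λ j → a j + - 1ℚ * a′ j) b ≗ (λ _ → 0ℚ)
  vanishes i = begin
    linearCombination (λ j → a j + - 1ℚ * a′ j) b i                   ≡⟨ linearCombination-+-* a a′ (- 1ℚ) b i ⟩
    linearCombination a b i + - 1ℚ * linearCombination a′ b i         ≡⟨ cong (λ p → p + - 1ℚ * linearCombination a′ b i) (eq i) ⟩
    linearCombination a′ b i + - 1ℚ * linearCombination a′ b i        ≡⟨ cancel (linearCombination a′ b i) ⟩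
    0ℚ                                                                ∎

-- Invertibility, independence and spanning for square matrices.

-- Spanning the rows of the identity gives a left inverse `B`. It is also a right inverse:
-- `(A · B) · A` equals `A`, and independence of the rows cancels the last factor.
independent-spanning⇒invertible : ∀ {n} (A : Matrix n n) → LinearlyIndependent A →
  (∀ w → w ∈ Span A) → Invertible A
independent-spanning⇒invertible A ind spans = B , A·B , B·A
  where
  B = λ i → proj₁ (spans (identity i))

  B·A : ∀ i j → (B · A) i j ≡ identity i j
  B·A i j = sym (proj₂ (spans (identity i)) j)

  A·B : ∀ i j → (A · B) i j ≡ identity i j
  A·B i = independent-injective ind ((A · B) i) (identity i) λ j → begin
    linearCombination (linearCombination (A i) B) A j  ≡⟨ linearCombination-assoc (A i) B A j ⟩
    linearCombination (A i) (B · A) j                  ≡⟨ linearCombination-congʳ (A i) (B · A) identity j (λ l → B·A l j) ⟩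
    linearCombination (A i) identity j                 ≡⟨ linearCombination-identityʳ (A i) j ⟩
    A i j                                              ≡⟨ linearCombination-identityˡ i A j ⟨
    linearCombination (identity i) A j                 ∎

invertible⇒independent : ∀ {n} (A : Matrix n n) → Invertible A → LinearlyIndependent A
invertible⇒independent A (B , A·B , _) a aA≗0 i = begin
  a i                                            ≡⟨ linearCombination-identityʳ a i ⟨
  linearCombination a identity i                 ≡⟨ linearCombination-congʳ a (A · B) identity i (λ j → A·B j i) ⟨
  linearCombination a (A · B) i                  ≡⟨ linearCombination-assoc a A B i ⟨
  linearCombination (linearCombination a A) B i  ≡⟨ linearCombination-zeroˡ B aA≗0 i ⟩
  0ℚ                                             ∎

invertible⇒spanning : ∀ {n} (A : Matrix n n) → Invertible A → ∀ w → w ∈ Span A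
invertible⇒spanning A (B , _ , B·A) w = linearCombination w B , λ i → begin
  w i                                            ≡⟨ linearCombination-identityʳ w i ⟨
  linearCombination w identity i                 ≡⟨ linearCombination-congʳ w (B · A) identity i (λ j → B·A j i) ⟨
  linearCombination w (B · A) i                  ≡⟨ linearCombination-assoc w B A i ⟨
  linearCombination (linearCombination w B) A i  ∎

transpose-invertible : ∀ {n} (A : Matrix n n) → Invertible A → Invertible (transpose A)
transpose-invertible A (B , A·B , B·A) = transpose B ,
  (λ i j → trans (transpose-· B A j i) (trans (B·A j i) (identity-sym j i))) ,
  (λ i j → trans (transpose-· A B j i) (trans (A·B j i) (identity-sym j i)))
  where
  transpose-· : ∀ A B i j → (transpose B · transpose A) j i ≡ (A · B) i j
  transpose-· A B i j = sum-cong-≗ λ l → ℚ.*-comm (B l j) (A i l)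

-- If z expresses the rest of the first row through the block, then the first
-- row minus z times the others is (s , 0 , … , 0), where independence gives
-- s ≢ 0: it corrects the first entry of a solution for the block.
spanning-by-trailing-block : ∀ {n} (A : Matrix (suc n) (suc n)) → LinearlyIndependent A →
  (∀ w → w ∈ Span (tail ∘ tail A)) → ∀ w → w ∈ Span A
spanning-by-trailing-block {n} A ind spans w = coefficients t y , solves
  where
  open +-*-Solver

  z = proj₁ (spans (tail (A zero)))
  y = proj₁ (spans (tail w))

  residue : Vector ℚ (suc n)
  residue j = A zero j + - linearCombination z (tail A) j

  s = residue zero

  residue-tail : ∀ j → residue (suc j) ≡ 0ℚ
  residue-tail j = trans
    (cong (λ p → A zero (suc j) + - p) (sym (proj₂ (spans (tail (A zero))) j)))
    (ℚ.+-inverseʳ (A zero (suc j)))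

  coefficients : ℚ → Vector ℚ n → Vector ℚ (suc n)
  coefficients t y = t ∷ λ i → y i + - t * z i

  combination : ∀ t y j → linearCombination (coefficients t y) A j
                        ≡ linearCombination y (tail A) j + t * residue j
  combination t y j = begin
    t * A zero j + linearCombination (λ i → y i + - t * z i) (tail A) j
      ≡⟨ cong (λ p → t * A zero j + p) (linearCombination-+-* y z (- t) (tail A) j) ⟩
    t * A zero j + (linearCombination y (tail A) j + - t * linearCombination z (tail A) j)
      ≡⟨ solve 4 (λ t a p q → t :* a :+ (p :+ :- t :* q) := p :+ t :* (a :+ :- q)) refl
           t (A zero j) (linearCombination y (tail A) j) (linearCombination z (tail A) j) ⟩
    linearCombination y (tail A) j + t * residue j ∎

  s≢0 : s ≢ 0ℚ
  -- With `s` equal to 0, the coefficients 1 and minus `z` would give a vanishing combination whose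
  -- first coefficient is 1.
  s≢0 s≡0 = ℚ.1≢0 (ind (coefficients 1ℚ (λ _ → 0ℚ)) vanishes zero)
    where
    residue≡0 : ∀ j → residue j ≡ 0ℚ
    residue≡0 zero    = s≡0
    residue≡0 (suc j) = residue-tail j

    vanishes : ∀ j → linearCombination (coefficients 1ℚ (λ _ → 0ℚ)) A j ≡ 0ℚ
    vanishes j = trans (combination 1ℚ (λ _ → 0ℚ) j)
      (cong₂ (λ p q → p + 1ℚ * q) (linearCombination-zeroˡ (tail A) (λ _ → refl) j) (residue≡0 j))

  instance
    s-nonZero : ℚ.NonZero s
    s-nonZero = ℚ.≢-nonZero s≢0

  w₀ = linearCombination y (tail A) zero

  t = (w zero + - w₀) * 1/ s

  solves : w ≗ linearCombination (coefficients t y) A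
  solves zero = sym (begin
    linearCombination (coefficients t y) A zero  ≡⟨ combination t y zero ⟩
    w₀ + (w zero + - w₀) * 1/ s * s              ≡⟨ cong (λ p → w₀ + p) (ℚ.*-assoc (w zero + - w₀) (1/ s) s) ⟩
    w₀ + (w zero + - w₀) * (1/ s * s)            ≡⟨ cong (λ p → w₀ + (w zero + - w₀) * p) (ℚ.*-inverseˡ s) ⟩
    w₀ + (w zero + - w₀) * 1ℚ                    ≡⟨ solve 2 (λ p q → p :+ (q :+ :- p) :* con 1ℚ := q) refl w₀ (w zero) ⟩
    w zero                                       ∎)
  solves (suc j) = sym (begin
    linearCombination (coefficients t y) A (suc j)
      ≡⟨ combination t y (suc j) ⟩
    linearCombination y (tail A) (suc j) + t * residue (suc j)
      ≡⟨ cong₂ (λ p q → p + t * q) (sym (proj₂ (spans (tail w)) j)) (residue-tail j) ⟩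
    w (suc j) + t * 0ℚ
      ≡⟨ solve 2 (λ p t → p :+ t :* con 0ℚ := p) refl (w (suc j)) t ⟩
    w (suc j) ∎)

-- Invertibility for ordered pairs.

ordered⇒independent : ∀ {k} (r c : Vector ℕ k) → Selection r → Selection c →
  (∀ i → r i ≤ c i) → LinearlyIndependent T[ r , c ]
ordered⇒independent r c r↑ c↑ r≤c a vanishes =
  newton-injective a r c r↑ c↑ r≤c λ j _ → vanishes j

ordered⇒spanning : ∀ {k} (r c : Vector ℕ k) → Selection r → Selection c →
  (∀ i → r i ≤ c i) → ∀ w → w ∈ Span T[ r , c ]
ordered⇒spanning {zero}  r c r↑ c↑ r≤c w = w , λ ()
ordered⇒spanning {suc k} r c r↑ c↑ r≤c =
  spanning-by-trailing-block T[ r , c ] (ordered⇒independent r c r↑ c↑ r≤c)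
    (ordered⇒spanning (tail r) (tail c) (r↑ ∘ s≤s) (c↑ ∘ s≤s) (r≤c ∘ suc))

ordered⇒invertible : ∀ {k} (r c : Vector ℕ k) → Selection r → Selection c →
  (∀ i → r i ≤ c i) → Invertible T[ r , c ]
ordered⇒invertible r c r↑ c↑ r≤c = independent-spanning⇒invertible T[ r , c ]
  (ordered⇒independent r c r↑ c↑ r≤c) (ordered⇒spanning r c r↑ c↑ r≤c)

-- Subsequences and sorted insertion.

Selection-mono-≤ : ∀ {k} {r : Vector ℕ k} → Selection r → ∀ i j → i Fin.≤ j → r i ≤ r j
Selection-mono-≤ {r = r} r↑ i j i≤j with i Fin.≟ j
... | yes refl = ℕ.≤-refl
... | no  i≢j  = ℕ.<⇒≤ (r↑ (Fin.≤∧≢⇒< i≤j i≢j))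

Selection-cancel-< : ∀ {k} {r : Vector ℕ k} → Selection r → ∀ i j → r i < r j → i Fin.< j
Selection-cancel-< r↑ i j rᵢ<rⱼ = ℕ.≰⇒> λ j≤i → ℕ.<⇒≱ rᵢ<rⱼ (Selection-mono-≤ r↑ j i j≤i)

subsequence-selection : ∀ {k l} {s : Vector ℕ k} {t : Vector ℕ l} →
  Selection s → Subsequence t s → Selection t
subsequence-selection s↑ (f , f↑ , t≡s∘f) {i} {j} i<j =
  subst₂ _<_ (sym (t≡s∘f i)) (sym (t≡s∘f j)) (s↑ (f↑ i<j))

-- Membership suffices, because a selection reflects the order and so forces the positions to
-- increase.
selection-subsequence : ∀ {k l} {s : Vector ℕ k} {t : Vector ℕ l} →
  Selection s → Selection t → (∀ i → ∃[ j ] t i ≡ s j) → Subsequence t s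
selection-subsequence s↑ t↑ t⊆s = (λ i → proj₁ (t⊆s i)) ,
  (λ {i} {j} i<j → Selection-cancel-< s↑ _ _ (subst₂ _<_ (proj₂ (t⊆s i)) (proj₂ (t⊆s j)) (t↑ i<j))) ,
  (λ i → proj₂ (t⊆s i))

insert : ∀ {k} → ℕ → Vector ℕ k → Vector ℕ (suc k)
insert {zero}  x s = x ∷ s
insert {suc k} x s with x ℕ.<? head s
... | yes _ = x ∷ s
... | no  _ = head s ∷ insert x (tail s)

insert-∈ : ∀ {k} x (s : Vector ℕ k) i → insert x s i ≡ x ⊎ ∃[ j ] insert x s i ≡ s j
insert-∈ {zero}  x s zero = inj₁ refl
insert-∈ {suc k} x s i with x ℕ.<? head s
insert-∈ {suc k} x s zero    | yes _ = inj₁ refl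
insert-∈ {suc k} x s (suc i) | yes _ = inj₂ (i , refl)
insert-∈ {suc k} x s zero    | no _  = inj₂ (zero , refl)
insert-∈ {suc k} x s (suc i) | no _ with insert-∈ x (tail s) i
... | inj₁ eq       = inj₁ eq
... | inj₂ (j , eq) = inj₂ (suc j , eq)

insert-> : ∀ {k} x (s : Vector ℕ k) {y} → y < x → (∀ i → y < s i) → ∀ i → y < insert x s i
insert-> x s {y} y<x y<s i with insert-∈ x s i
... | inj₁ eq       = subst (y <_) (sym eq) y<x
... | inj₂ (j , eq) = subst (y <_) (sym eq) (y<s j)

insert-selection : ∀ {k} x (s : Vector ℕ k) → Selection s → (∀ i → s i ≢ x) → Selection (insert x s)
insert-selection {zero}  x s s↑ x∉s {zero} {suc ()} _
insert-selection {suc k} x s s↑ x∉s {i} {j} i<j with x ℕ.<? head s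
insert-selection {suc k} x s s↑ x∉s {zero}  {suc j} _         | yes x<s₀ =
  ℕ.<-≤-trans x<s₀ (Selection-head-≤ {r = s} s↑ j)
insert-selection {suc k} x s s↑ x∉s {suc i} {suc j} (s≤s i<j) | yes x<s₀ = s↑ i<j
insert-selection {suc k} x s s↑ x∉s {zero}  {suc j} _         | no x≮s₀ =
  insert-> x (tail s) (ℕ.≤∧≢⇒< (ℕ.≮⇒≥ x≮s₀) (x∉s zero)) (λ i → s↑ z<s) j
insert-selection {suc k} x s s↑ x∉s {suc i} {suc j} (s≤s i<j) | no x≮s₀ =
  insert-selection x (tail s) (s↑ ∘ s≤s) (x∉s ∘ suc) i<j

-- An insertion leaves an entry in place or moves it up by one position. Hence, together with
-- `≤-insert-suc`, the old and the new sequence interlace.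
insert-inject₁-≤ : ∀ {k} x (s : Vector ℕ k) → Selection s → ∀ i → insert x s (inject₁ i) ≤ s i
insert-inject₁-≤ {suc k} x s s↑ i with x ℕ.<? head s
insert-inject₁-≤ {suc k} x s s↑ zero    | yes x<s₀ = ℕ.<⇒≤ x<s₀
insert-inject₁-≤ {suc k} x s s↑ (suc i) | yes x<s₀ = Selection-mono-≤ s↑ (inject₁ i) (suc i)
  (subst (_≤ suc (toℕ i)) (sym (Fin.toℕ-inject₁ i)) (ℕ.n≤1+n (toℕ i)))
insert-inject₁-≤ {suc k} x s s↑ zero    | no _ = ℕ.≤-refl
insert-inject₁-≤ {suc k} x s s↑ (suc i) | no _ = insert-inject₁-≤ x (tail s) (s↑ ∘ s≤s) i

≤-insert-suc : ∀ {k} x (s : Vector ℕ k) → Selection s → ∀ i → s i ≤ insert x s (suc i)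
≤-insert-suc {suc k} x s s↑ i with x ℕ.<? head s
≤-insert-suc {suc k} x s s↑ i       | yes _ = ℕ.≤-refl
≤-insert-suc {suc zero}    x s s↑ zero | no x≮s₀ = ℕ.≮⇒≥ x≮s₀
≤-insert-suc {suc (suc k)} x s s↑ zero | no x≮s₀ with x ℕ.<? s (suc zero)
... | yes _ = ℕ.≮⇒≥ x≮s₀
... | no  _ = ℕ.<⇒≤ (s↑ z<s)
≤-insert-suc {suc k} x s s↑ (suc i) | no _ = ≤-insert-suc x (tail s) (s↑ ∘ s≤s) i

-- The positions split at the place of `x`, with shifted entries of `s` after it; `insert-≥` makes
-- the mirror split. Together they locate a position at which two insertions are out of order.
insert-≤ : ∀ {k} x (s : Vector ℕ k) → Selection s →
  ∀ i → insert x s i ≤ x ⊎ ∃[ j ] i ≡ suc j × insert x s i ≡ s j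
insert-≤ {zero}  x s s↑ zero = inj₁ ℕ.≤-refl
insert-≤ {suc k} x s s↑ i with x ℕ.<? head s
insert-≤ {suc k} x s s↑ zero    | yes _    = inj₁ ℕ.≤-refl
insert-≤ {suc k} x s s↑ (suc i) | yes _    = inj₂ (i , refl , refl)
insert-≤ {suc k} x s s↑ zero    | no x≮s₀  = inj₁ (ℕ.≮⇒≥ x≮s₀)
insert-≤ {suc k} x s s↑ (suc i) | no _ with insert-≤ x (tail s) (s↑ ∘ s≤s) i
... | inj₁ ≤x              = inj₁ ≤x
... | inj₂ (j , refl , eq) = inj₂ (suc j , refl , eq)

insert-≥ : ∀ {k} x (s : Vector ℕ k) → Selection s →
  ∀ i → x ≤ insert x s i ⊎ ∃[ j ] i ≡ inject₁ j × insert x s i ≡ s j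
insert-≥ {zero}  x s s↑ zero = inj₁ ℕ.≤-refl
insert-≥ {suc k} x s s↑ i with x ℕ.<? head s
insert-≥ {suc k} x s s↑ zero    | yes _    = inj₁ ℕ.≤-refl
insert-≥ {suc k} x s s↑ (suc i) | yes x<s₀ = inj₁ (ℕ.≤-trans (ℕ.<⇒≤ x<s₀) (Selection-head-≤ {r = s} s↑ i))
insert-≥ {suc k} x s s↑ zero    | no _     = inj₂ (zero , refl , refl)
insert-≥ {suc k} x s s↑ (suc i) | no _ with insert-≥ x (tail s) (s↑ ∘ s≤s) i
... | inj₁ x≤              = inj₁ x≤
... | inj₂ (j , refl , eq) = inj₂ (suc j , refl , eq)

insert-subsequence : ∀ {k l} {t : Vector ℕ k} {s : Vector ℕ l} → Selection s → Subsequence t s →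
  ∀ i → (∀ j → t j ≢ s i) → Subsequence (insert (s i) t) s
insert-subsequence {t = t} {s} s↑ t⊑s@(f , _ , t≡s∘f) i i∉t = selection-subsequence s↑
  (insert-selection (s i) t (subsequence-selection {t = t} s↑ t⊑s) i∉t)
  λ j → case insert-∈ (s i) t j of λ where
    (inj₁ eq)       → i , eq
    (inj₂ (l , eq)) → f l , trans eq (t≡s∘f l)

-- In the second case T[ r , c ], also when bordered by the row x and the column
-- y, is block upper triangular: rows ≥ ρ vanish in y and in each c i with r i < ρ.
insert-ordered-or-separated : ∀ {k} (r c : Vector ℕ k) → Selection r → Selection c → (∀ i → r i ≤ c i) →
  ∀ x y → (∀ i → r i ≢ x) → (∀ i → c i ≢ y) →
  (∀ i → insert x r i ≤ insert y c i) ⊎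
  ∃[ ρ ] y < ρ × ρ ≤ x × (∀ i → r i < ρ → c i < ρ)
insert-ordered-or-separated r c r↑ c↑ r≤c x y x∉r y∉c
  with Fin.all? (λ i → insert x r i ℕ.≤? insert y c i)
... | yes ordered = inj₁ ordered
... | no ¬ordered with Fin.¬∀⟶∃¬ _ _ (λ i → insert x r i ℕ.≤? insert y c i) ¬ordered
-- The threshold `ρ` is the new row entry at a position `q` where the enlarged pair is out of order.
... | q , rq≰cq = inj₂ (insert x r q , ℕ.≤-<-trans y≤cq cq<rq , rq≤x , separated)
  where
  cq<rq : insert y c q < insert x r q
  cq<rq = ℕ.≰⇒> rq≰cq

  y≤cq : y ≤ insert y c q
  y≤cq with insert-≥ y c c↑ q
  ... | inj₁ y≤              = y≤
  -- If `y` came after `q`, the column at `q` would be the old `c j`, while the row there is at most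
  -- `r j`.
  ... | inj₂ (j , refl , eq) = contradiction
    (ℕ.≤-trans (insert-inject₁-≤ x r r↑ j) (ℕ.≤-trans (r≤c j) (ℕ.≤-reflexive (sym eq)))) rq≰cq

  rq≤x : insert x r q ≤ x
  rq≤x with insert-≤ x r r↑ q
  ... | inj₁ ≤x              = ≤x
  -- If `x` came before `q`, the row at `q` would be the old `r j`, while the column there is at
  -- least `c j`.
  ... | inj₂ (j , refl , eq) = contradiction
    (ℕ.≤-trans (ℕ.≤-reflexive eq) (ℕ.≤-trans (r≤c j) (≤-insert-suc y c c↑ j))) rq≰cq

  separated : ∀ i → r i < insert x r q → c i < insert x r q
  -- A row below `ρ` has index `i` less than `q`, so `c i` is at most the new column entry at `q`,
  -- which is below `ρ`.
  separated i rᵢ<rq = ℕ.≤-<-trans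
    (ℕ.≤-trans (≤-insert-suc y c c↑ i) (Selection-mono-≤ (insert-selection y c c↑ y∉c) (suc i) q i<q)) cq<rq
    where
    i<q : toℕ i < toℕ q
    i<q = subst (_< toℕ q) (Fin.toℕ-inject₁ i)
      (Selection-cancel-< (insert-selection x r r↑ x∉r) (inject₁ i) q
        (ℕ.≤-<-trans (insert-inject₁-≤ x r r↑ i) rᵢ<rq))

-- Truncated coefficients and the separated case.

-- Coefficients are set to 0 instead of being removed, so that `newton-injective` applies with the
-- same `r` and `c`.
mask : ∀ {P : Set} → Dec P → ℚ → ℚ
mask (yes _) x = x
mask (no  _) x = 0ℚ

mask-support : ∀ {P : Set} (P? : Dec P) x → mask P? x ≢ 0ℚ → P
mask-support (yes p) x _   = p
mask-support (no  _) x 0≢0 = contradiction refl 0≢0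

mask-* : ∀ {P : Set} (P? : Dec P) x {y} → (¬ P → y ≡ 0ℚ) → mask P? x * y ≡ x * y
mask-* (yes _)  x     _   = refl
mask-* (no  ¬p) x {y} y≡0 = begin
  0ℚ * y  ≡⟨ ℚ.*-zeroˡ y ⟩
  0ℚ      ≡⟨ ℚ.*-zeroʳ x ⟨
  x * 0ℚ  ≡⟨ cong (x *_) (y≡0 ¬p) ⟨
  x * y   ∎

-- Before `ρ`, truncating `a` to the rows below `ρ` does not change the sum. At the columns paired
-- with these rows the sum agrees with row `x`, which vanishes there, so the truncation is zero by
-- injectivity and both sides vanish at `y`.
newton-separated : ∀ {k} (r c : Vector ℕ k) → Selection r → Selection c → (∀ i → r i ≤ c i) →
  ∀ {x y ρ} → y < ρ → ρ ≤ x → (∀ i → r i < ρ → c i < ρ) →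
  ∀ a → (∀ j → T x (c j) ≡ newton a r (c j)) → T x y ≡ newton a r y
newton-separated r c r↑ c↑ r≤c {x} {y} {ρ} y<ρ ρ≤x separated a a-solves = begin
  T x y          ≡⟨ T-below (ℕ.<-≤-trans y<ρ ρ≤x) ⟩
  0ℚ             ≡⟨ sum-zero _ (λ i → trans (cong (_* T (r i) y) (a′≡0 i)) (ℚ.*-zeroˡ (T (r i) y))) ⟨
  newton a′ r y  ≡⟨ truncate y<ρ ⟩
  newton a r y   ∎
  where
  a′ = λ i → mask (r i ℕ.<? ρ) (a i)

  truncate : ∀ {t} → t < ρ → newton a′ r t ≡ newton a r t
  truncate t<ρ = sum-cong-≗ λ i →
    mask-* (r i ℕ.<? ρ) (a i) λ rᵢ≮ρ → T-below (ℕ.<-≤-trans t<ρ (ℕ.≮⇒≥ rᵢ≮ρ))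

  a′≡0 : ∀ i → a′ i ≡ 0ℚ
  a′≡0 = newton-injective a′ r c r↑ c↑ r≤c λ j a′≢0 →
    let cⱼ<ρ = separated j (mask-support (r j ℕ.<? ρ) (a j) a′≢0) in begin
    newton a′ r (c j)  ≡⟨ truncate cⱼ<ρ ⟩
    newton a r (c j)   ≡⟨ a-solves j ⟨
    T x (c j)          ≡⟨ T-below (ℕ.<-≤-trans cⱼ<ρ ρ≤x) ⟩
    0ℚ                 ∎

-- Ranks and spaces for ordered and maximal sub-pairs.

module _ {m n k} {r : Vector ℕ m} {c : Vector ℕ n} {r̂ ĉ : Vector ℕ k}
         (r↑ : Selection r) (c↑ : Selection c) (pair : OrderedSubPair r c r̂ ĉ) where

  open OrderedSubPair pair

  private
    f = proj₁ rows
    r̂≡r∘f = proj₂ (proj₂ rows)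
    g = proj₁ columns
    ĉ≡c∘g = proj₂ (proj₂ columns)

    r̂↑ : Selection r̂
    r̂↑ = subsequence-selection {t = r̂} r↑ rows

    ĉ↑ : Selection ĉ
    ĉ↑ = subsequence-selection {t = ĉ} c↑ columns

  subpair-invertible : Invertible T[ r̂ , ĉ ]
  subpair-invertible = ordered⇒invertible r̂ ĉ r̂↑ ĉ↑ ordered

  subpair-submatrix : IsSubmatrix T[ r̂ , ĉ ] T[ r , c ]
  subpair-submatrix = f , g , proj₁ (proj₂ rows) , proj₁ (proj₂ columns) ,
    λ i j → cong₂ T (r̂≡r∘f i) (ĉ≡c∘g j)

  private
    transposed-invertible : Invertible (transpose T[ r̂ , ĉ ])
    transposed-invertible = transpose-invertible T[ r̂ , ĉ ] subpair-invertible

    columns-spanning : ∀ w → w ∈ Span (transpose T[ r̂ , ĉ ])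
    columns-spanning = invertible⇒spanning (transpose T[ r̂ , ĉ ]) transposed-invertible

    columns-independent : LinearlyIndependent (transpose T[ r̂ , ĉ ])
    columns-independent = invertible⇒independent (transpose T[ r̂ , ĉ ]) transposed-invertible

  row-contained : ∀ {l} (s : Vector ℕ l) i → T[ r̂ , s ] i ∈ RowSpace T[ r , s ]
  row-contained s i = Span-resp-≗ T[ r , s ] (λ j → cong (λ x → T x (s j)) (r̂≡r∘f i))
    (Span-generator T[ r , s ] (f i))

  column-contained : ∀ {l} (s : Vector ℕ l) j → transpose T[ s , ĉ ] j ∈ ColumnSpace T[ s , c ]
  column-contained s j = Span-resp-≗ (transpose T[ s , c ]) (λ i → cong (T (s i)) (ĉ≡c∘g j))
    (Span-generator (transpose T[ s , c ]) (g j))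

  -- A relation between these columns restricts to the rows `r̂`, where the square block is
  -- invertible.
  all-columns-independent : LinearlyIndependent (transpose T[ r , ĉ ])
  all-columns-independent a vanishes = columns-independent a λ i → trans
    (sum-cong-≗ λ j → cong (λ x → a j * T x (ĉ j)) (r̂≡r∘f i)) (vanishes (f i))

  -- Rank is the dimension of the column space; the columns `ĉ` form an invertible block and hence a
  -- basis of the whole space.
  subpair-fullRowRank : FullRowRank T[ r̂ , c ]
  subpair-fullRowRank = transpose T[ r̂ , ĉ ] , record
    { contained   = column-contained r̂
    ; independent = columns-independent
    ; spanning    = λ v _ → columns-spanning v
    }

  subpair-fullColumnRank : FullColumnRank T[ r , ĉ ]
  subpair-fullColumnRank = transpose T[ r , ĉ ] , record
    { contained   = Span-generator (transpose T[ r , ĉ ])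
    ; independent = all-columns-independent
    ; spanning    = λ _ v∈ → v∈
    }

  module _ (maximal : ∀ {l} (r′ c′ : Vector ℕ l) → OrderedSubPair r c r′ c′ → l ≤ k) where

    -- Coefficients that match row `i` on the columns `ĉ` also match it on every other column: by
    -- maximality `r i` and `c j` cannot both be inserted, which leaves the separated case.
    maximal-row : ∀ i → T[ r , c ] i ∈ RowSpace T[ r̂ , c ]
    maximal-row i = case Fin.any? (λ l → r̂ l ℕ.≟ r i) of λ where
        (yes (l , r̂ₗ≡rᵢ)) → Span-resp-≗ T[ r̂ , c ] (λ j → cong (λ x → T x (c j)) (sym r̂ₗ≡rᵢ))
          (Span-generator T[ r̂ , c ] l)
        (no rᵢ∉r̂) → a , λ j → case Fin.any? (λ l → ĉ l ℕ.≟ c j) of λ where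
          (yes (l , ĉₗ≡cⱼ)) → subst (λ y → T (r i) y ≡ newton a r̂ y) ĉₗ≡cⱼ (a-solves l)
          (no cⱼ∉ĉ) → new-entry j (λ l eq → rᵢ∉r̂ (l , eq)) (λ l eq → cⱼ∉ĉ (l , eq))
      where
      solution : T[ r , ĉ ] i ∈ Span T[ r̂ , ĉ ]
      solution = ordered⇒spanning r̂ ĉ r̂↑ ĉ↑ ordered (T[ r , ĉ ] i)

      a = proj₁ solution
      a-solves = proj₂ solution

      new-entry : ∀ j → (∀ l → r̂ l ≢ r i) → (∀ l → ĉ l ≢ c j) → T (r i) (c j) ≡ newton a r̂ (c j)
      new-entry j rᵢ∉r̂ cⱼ∉ĉ =
        case insert-ordered-or-separated r̂ ĉ r̂↑ ĉ↑ ordered (r i) (c j) rᵢ∉r̂ cⱼ∉ĉ of λ where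
          (inj₁ extended) → contradiction
            (maximal (insert (r i) r̂) (insert (c j) ĉ) record
              { rows    = insert-subsequence r↑ rows i rᵢ∉r̂
              ; columns = insert-subsequence c↑ columns j cⱼ∉ĉ
              ; ordered = extended
              })
            ℕ.1+n≰n
          (inj₂ (ρ , cⱼ<ρ , ρ≤rᵢ , separated)) →
            newton-separated r̂ ĉ r̂↑ ĉ↑ ordered cⱼ<ρ ρ≤rᵢ separated a a-solves

    -- The coefficients `x` express column `j` on the rows `r̂` only. They work in every row because
    -- each row of `T[ r , c ]` is a combination of the rows `r̂`.
    maximal-column : ∀ j → transpose T[ r , c ] j ∈ ColumnSpace T[ r , ĉ ]
    maximal-column j = x , λ i → let a = proj₁ (maximal-row i) in begin
      T (r i) (c j)
        ≡⟨ proj₂ (maximal-row i) j ⟩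
      sum (λ l → a l * T (r̂ l) (c j))
        ≡⟨ sum-cong-≗ (λ l → cong (a l *_) (proj₂ (columns-spanning column) l)) ⟩
      sum (λ l → a l * linearCombination x (transpose T[ r̂ , ĉ ]) l)
        ≡⟨ linearCombination-swap a x T[ r̂ , ĉ ] ⟩
      sum (λ l → x l * newton a r̂ (ĉ l))
        -- The expansion of row `i` is known at columns of `c`, so `ĉ l` is rewritten as one of them
        -- and afterwards restored.
        ≡⟨ sum-cong-≗ (λ l → cong (λ y → x l * newton a r̂ y) (ĉ≡c∘g l)) ⟩
      sum (λ l → x l * newton a r̂ (c (g l)))
        ≡⟨ sum-cong-≗ (λ l → cong (x l *_) (proj₂ (maximal-row i) (g l))) ⟨
      sum (λ l → x l * T (r i) (c (g l)))
        ≡⟨ sum-cong-≗ (λ l → cong (λ y → x l * T (r i) y) (ĉ≡c∘g l)) ⟨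
      sum (λ l → x l * T (r i) (ĉ l)) ∎
      where
      column = λ l → T (r̂ l) (c j)
      x = proj₁ (columns-spanning column)

    maximal-rowSpace : RowSpace T[ r̂ , c ] ≐ RowSpace T[ r , c ]
    maximal-rowSpace = Span-least T[ r̂ , c ] T[ r , c ] (row-contained c) ,
                       Span-least T[ r , c ] T[ r̂ , c ] maximal-row

    maximal-columnSpace : ColumnSpace T[ r , ĉ ] ≐ ColumnSpace T[ r , c ]
    maximal-columnSpace = Span-least (transpose T[ r , ĉ ]) (transpose T[ r , c ]) (column-contained r) ,
                          Span-least (transpose T[ r , c ]) (transpose T[ r , ĉ ]) maximal-column

    maximal-rank : HasRank T[ r , c ] k
    maximal-rank = transpose T[ r , ĉ ] , record
      { contained   = column-contained r
      ; independent = all-columns-independent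
      ; spanning    = λ v v∈ → proj₂ maximal-columnSpace v∈
      }

theorem2 : ∀ (m n p : ℕ)
    (r : Vector ℕ (suc m)) (c : Vector ℕ (suc n)) →
    Selection r → Selection c →
    (r̂ ĉ : Vector ℕ (suc p)) →
    OrderedSubPair r c r̂ ĉ →
    ( (Invertible T[ r̂ , ĉ ] × IsSubmatrix T[ r̂ , ĉ ] T[ r , c ])
    × FullRowRank T[ r̂ , c ]
    × FullColumnRank T[ r , ĉ ] )
    ×
    ( MaximalOrderedSubPair r c r̂ ĉ →
    HasRank T[ r , c ] (suc p)
    × (ColumnSpace T[ r , ĉ ] ≐ ColumnSpace T[ r , c ])
    × (RowSpace T[ r̂ , c ] ≐ RowSpace T[ r , c ]) )
theorem2 m n p r c r↑ c↑ r̂ ĉ pair =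
  ( (subpair-invertible r↑ c↑ pair , subpair-submatrix r↑ c↑ pair)
  , subpair-fullRowRank r↑ c↑ pair
  , subpair-fullColumnRank r↑ c↑ pair ) ,
  λ maximalPair → let open MaximalOrderedSubPair maximalPair in
    maximal-rank r↑ c↑ pair maximal
  , maximal-columnSpace r↑ c↑ pair maximal
  , maximal-rowSpace r↑ c↑ pair maximal
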